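{- Let $p$ be a prime. For every rational number $\alpha\in\mathbb{Q}\subset\mathbb{Q}_p$ and each of Algorithms A, B and C, the continued fraction expansion of $\alpha$ obtained by that algorithm is finite.
   Context: Let $p$ be a prime, $v_p$ the $p$-adic additive valuation and $|\alpha|_p = p^{ -v_p(\alpha)}$. Each $\alpha\in\mathbb{Q}_p$ has a unique $p$-adic expansion $\alpha=\sum_{i} e_i p^i$ with $e_i\in\{0,1,\dots,p-1\}$ and $e_i\ne 0$ for at most finitely many $i\le 0$; put $[\alpha]=\sum_{i\le 0} e_i p^i$ and $\langle\alpha\rangle=\sum_{i\ge 1}e_ip^i$, so $\alpha=[\alpha]+\langle\alpha\rangle$. Let $A_p$ be the set of elements of $p\mathbb{Z}_p$ that are algebraic over $\mathbb{Q}$ of degree at most two. The minimal polynomial of an algebraic element is its integral polynomial of lowest degree with positive leading coefficient and coprime coefficients. For $x\in A_p$ write it as $aX^2+bX+c$ if $x$ is quadratic and as $bX+c$ if $x$ is rational. For $x\in A_p\setminus\{0\}$ put $u(x)=c|c|_p\in\mathbb{Z}\setminus p\mathbb{Z}$, and define maps $T_1,T_2:A_p\setminus\{0\}\to A_p$ by $$T_1(x)=\frac{u(x)p^{v_p(x)}}{x}-d_1(x),\qquad T_2(x)=\frac{ -u(x)p^{v_p(x)}}{x}-d_2(x),$$ where $d_1(x),d_2(x)\in\{1,\dots,p-1\}$ are the unique choices making $T_1(x),T_2(x)\in p\mathbb{Z}_p$. The three algorithms are given by the following maps $T:A_p\setminus\{0\}\to A_p$ (where the minimal polynomial of $x$ is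 $aX^2+bX+c$ if $x$ is quadratic and $bX+c$ if $x$ is rational). Algorithm A: $T(x)=T_2(x)$. Algorithm B: $T(x)=T_2(x)$ if $b\ge 0$, and $T(x)=T_1(x)$ if $b<0$. Algorithm C: $T(x)=T_2(x)$ if $b\ge 0$ and $c>0$, and $T(x)=T_1(x)$ otherwise. For a given algorithm put $t(x)=u(x)$, $d(x)=d_1(x)$ when $T(x)$ is defined as $T_1(x)$, and $t(x)=-u(x)$, $d(x)=d_2(x)$ when $T(x)$ is defined as $T_2(x)$; thus $T(x)=t(x)p^{v_p(x)}/x-d(x)$. The expansion of $\alpha\in\mathbb{Q}_p$ (algebraic of degree at most two) by the algorithm is the continued fraction $$[\alpha]+\cfrac{t_1p^{k_1}}{d_1+\cfrac{t_2p^{k_2}}{d_2+\cfrac{t_3p^{k_3}}{\ddots}}},\qquad t_i=t(T^{i-1}(\langle\alpha\rangle)),\ k_i=v_p(T^{i-1}(\langle\alpha\rangle)),\ d_i=d(T^{i-1}(\langle\alpha\rangle)),$$ which terminates after the $N$-th term if $T^N(\langle\alpha\rangle)=0$ for some (first) $N\ge 0$ (for $N=0$, i.e. $\langle\alpha\rangle=0$, it is just $[\alpha]$), and is infinite otherwise. The expansion is finite if such an $N$ exists. -}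

module Defs where

open import Data.Bool using (if_then_else_; _∧_)
open import Data.Fin as Fin using (Fin; toℕ)
open import Data.Integer as ℤ using (ℤ; +_; -[1+_]; 0ℤ; 1ℤ; _⊖_)
open import Data.Integer.Divisibility using (_∣_)
open import Data.Integer.GCD using (gcd)
import Data.Integer.Properties as ℤ
open import Data.List using (List; []; _∷_)
open import Data.Nat as ℕ using (ℕ; zero; suc; NonZero)
open import Data.Nat.Divisibility using () renaming (_∣_ to _∣ℕ_)
import Data.Nat.Properties as ℕ
open import Data.Nat.Primality using (Prime; prime⇒nonZero)
open import Data.Product using (∃; _×_)
open import Data.Rational as ℚ using (ℚ; 0ℚ; ↧ₙ_; _+_; _*_; _-_; _/_)
open import Relation.Binary.PropositionalEquality using (_≡_; _≢_)
open import Relation.Nullary using (¬_)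
open import Relation.Nullary.Decidable using (⌊_⌋)

ι : ℤ → ℚ
ι a = a / 1

Σ[<_] : ℕ → (ℕ → ℚ) → ℚ
Σ[< zero  ] f = 0ℚ
Σ[< suc n ] f = Σ[< n ] f + f n

-- Polynomials bX+c and aX²+bX+c; leading coefficients may be 0 here.
data Poly : Set where
  linear    : (b c : ℤ) → Poly
  quadratic : (a b c : ℤ) → Poly

coeff₁ coeff₀ leading content : Poly → ℤ

coeff₁ (linear b c)      = b
coeff₁ (quadratic a b c) = b

coeff₀ (linear b c)      = c
coeff₀ (quadratic a b c) = c

leading (linear b c)      = b
leading (quadratic a b c) = a

content (linear b c)      = gcd b c
content (quadratic a b c) = gcd a (gcd b c)

eval : Poly → ℚ → ℚ
eval (linear b c)      q = ι b * q + ι c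
eval (quadratic a b c) q = ι a * (q * q) + ι b * q + ι c

data Algorithm : Set where
  A B C : Algorithm

data Branch : Set where
  T₁ T₂ : Branch

-- Which of T₁, T₂ the algorithm applies to a number with minimal polynomial f.
branch : Algorithm → Poly → Branch
branch A f = T₂
branch B f = if ⌊ 0ℤ ℤ.≤? coeff₁ f ⌋ then T₂ else T₁
branch C f = if ⌊ 0ℤ ℤ.≤? coeff₁ f ⌋ ∧ ⌊ 0ℤ ℤ.<? coeff₀ f ⌋ then T₂ else T₁

signed : Branch → ℤ → ℤ
signed T₁ u = u
signed T₂ u = ℤ.- u

-- The data (tᵢ , kᵢ , dᵢ) of one level tᵢ p^kᵢ / (dᵢ + …).
record Term : Set where
  constructor term
  field
    t : ℤ
    k : ℤ
    d : ℕ

record FiniteContinuedFraction : Set where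
  constructor cf
  field
    integralPart : ℚ
    terms        : List Term

module _ (p : ℕ) (p-prime : Prime p) where

  private instance
    p≢0 : NonZero p
    p≢0 = prime⇒nonZero p-prime

  pow : ℤ → ℚ
  pow (+ n)    = ι (+ (p ℕ.^ n))
  pow -[1+ n ] = _/_ 1ℤ (p ℕ.^ suc n) {{ℕ.m^n≢0 p (suc n)}}

  -- vₚ(q) ≥ m, where vₚ(0) = ∞: the number q p⁻ᵐ has reduced denominator
  -- prime to p.
  Valuation≥ : ℤ → ℚ → Set
  Valuation≥ m q = ¬ (p ∣ℕ ↧ₙ (q * pow (ℤ.- m)))

  -- p-adic convergence to 0 of a sequence of rationals.
  Null : (ℕ → ℚ) → Set
  Null f = ∀ (m : ℕ) → ∃ λ N → ∀ n → N ℕ.≤ n → Valuation≥ (+ m) (f n)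

  -- A p-adic number is given by its p-adic expansion Σᵢ eᵢ pⁱ, where eᵢ = 0
  -- for i < - start; start is only a bound, not the exact order.
  record ℚₚ : Set where
    field
      digit   : ℤ → Fin p
      start   : ℕ
      bounded : ∀ i → i ℤ.< ℤ.- (+ start) → toℕ (digit i) ≡ 0

  open ℚₚ public

  -- Σ_{i ≤ n} eᵢ pⁱ; the j-th summand has index i = j - start.
  partialSum : ℚₚ → ℕ → ℚ
  partialSum x n = Σ[< start x ℕ.+ suc n ] λ j →
    ι (+ toℕ (digit x (j ⊖ start x))) * pow (j ⊖ start x)

  -- Field operations on ℚₚ are continuous, so a polynomial identity between
  -- p-adic numbers holds iff the corresponding expression in their partial
  -- sums tends to 0.  All arithmetic statements about ℚₚ below have this form.

  -- x is the image of the rational number q in ℚₚ.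
  _≈ℚ_ : ℚₚ → ℚ → Set
  x ≈ℚ q = Null λ n → partialSum x n - q

  Root : Poly → ℚₚ → Set
  Root f x = Null λ n → eval f (partialSum x n)

  IsZero : ℚₚ → Set
  IsZero x = ∀ i → toℕ (digit x i) ≡ 0

  -- vₚ(x) = k, for x ≠ 0.
  HasValuation : ℚₚ → ℤ → Set
  HasValuation x k =
    toℕ (digit x k) ≢ 0 × (∀ i → i ℤ.< k → toℕ (digit x i) ≡ 0)

  -- Membership in pℤₚ.
  InMaximalIdeal : ℚₚ → Set
  InMaximalIdeal x = ∀ i → i ℤ.≤ 0ℤ → toℕ (digit x i) ≡ 0

  [_] : ℚₚ → ℚ
  [ x ] = partialSum x 0

  private
    fractionalDigit : (ℤ → Fin p) → ℤ → Fin p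
    fractionalDigit e (+ suc i) = e (+ suc i)
    fractionalDigit e (+ zero)  = Fin.fromℕ< (ℕ.>-nonZero⁻¹ p)
    fractionalDigit e -[1+ i ]  = Fin.fromℕ< (ℕ.>-nonZero⁻¹ p)

    fractionalBounded : ∀ e i → i ℤ.< 0ℤ → toℕ (fractionalDigit e i) ≡ 0
    fractionalBounded e -[1+ i ] _ = toℕ-fromℕ< (ℕ.>-nonZero⁻¹ p)
      where open import Data.Fin.Properties using (toℕ-fromℕ<)
    fractionalBounded e (+ i) (ℤ.+<+ ())

  ⟨_⟩ : ℚₚ → ℚₚ
  ⟨ x ⟩ = record
    { digit   = fractionalDigit (digit x)
    ; start   = 0
    ; bounded = fractionalBounded (digit x)
    }

  -- No nonzero integral polynomial of smaller degree vanishes at x.  In the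
  -- linear case this is automatic, as nonzero constants do not vanish.
  LowestDegree : Poly → ℚₚ → Set
  LowestDegree (linear b c)      x = b ≢ 0ℤ
  LowestDegree (quadratic a b c) x =
    a ≢ 0ℤ × (∀ b′ c′ → Root (linear b′ c′) x → b′ ≡ 0ℤ × c′ ≡ 0ℤ)

  record IsMinimalPolynomial (f : Poly) (x : ℚₚ) : Set where
    field
      root         : Root f x
      lowestDegree : LowestDegree f x
      positive     : 0ℤ ℤ.< leading f
      coprime      : content f ≡ 1ℤ

  -- u = c |c|ₚ for c ≠ 0.
  record IsUnitPart (c u : ℤ) : Set where
    field
      v       : ℕ
      divides : + (p ℕ.^ v) ∣ c
      exact   : ¬ (+ (p ℕ.^ suc v) ∣ c)
      value   : ι u ≡ ι c * pow (ℤ.- (+ v))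

  -- The graph of T on Aₚ ∖ {0}: y = T(x), with t = t(x), k = vₚ(x), d = d(x).
  -- The equation y = t pᵏ / x - d is written (y + d) x = t pᵏ; here x ≠ 0
  -- because it has a valuation.
  record Step (alg : Algorithm) (x : ℚₚ) (τ : Term) (y : ℚₚ) : Set where
    open Term τ
    field
      x∈pℤₚ     : InMaximalIdeal x
      minPoly   : Poly
      isMinimal : IsMinimalPolynomial minPoly x
      u         : ℤ
      unitPart  : IsUnitPart (coeff₀ minPoly) u
      valuation : HasValuation x k
      t-value   : t ≡ signed (branch alg minPoly) u
      d-lower   : 1 ℕ.≤ d
      d-upper   : d ℕ.< p
      y∈pℤₚ     : InMaximalIdeal y
      equation  : Null λ n →
        (partialSum y n + ι (+ d)) * partialSum x n - ι t * pow k

  -- Iterates x , T(x) , … , Tᴺ(x) = 0, with the N terms they produce.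
  data Orbit (alg : Algorithm) : ℚₚ → List Term → Set where
    stop : ∀ {x} → IsZero x → Orbit alg x []
    step : ∀ {x τ y τs} → Step alg x τ y → Orbit alg y τs → Orbit alg x (τ ∷ τs)

  record HasExpansion (alg : Algorithm) (x : ℚₚ)
                      (e : FiniteContinuedFraction) : Set where
    open FiniteContinuedFraction e
    field
      integral : integralPart ≡ [ x ]
      orbit    : Orbit alg ⟨ x ⟩ terms

  FiniteExpansion : Algorithm → ℚₚ → Set
  FiniteExpansion alg x = ∃ λ e → HasExpansion alg x e

-- If x = -c/b in lowest terms, then c/x = -b, so T(x) is b - d or -b - d: an integer
-- divisible by p.  A nonzero integer y has minimal polynomial X - y, so T₂(y) = 1 - 1 = 0
-- and T₁(y) = -1 - (p - 1) = -p.  All three algorithms use T₂ for y < 0, hence every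
-- expansion stops after at most three steps.
module Submission where

open import Defs
open import Data.Fin as Fin using (Fin; toℕ)
import Data.Fin.Properties as Fin
open import Data.Integer as ℤ using (ℤ; +_; -[1+_]; 0ℤ; 1ℤ; _⊖_; ∣_∣)
open import Data.Integer.Divisibility.Signed
  using (_∣_; divides; ∣-refl; ∣-trans; ∣ᵤ⇒∣; ∣⇒∣ᵤ; ∣m+n∣m⇒∣n; ∣m+n∣n⇒∣m; ∣n⇒∣m*n; ∣m⇒∣m*n;
         ∣m⇒∣-m; ∣m∣n⇒∣m-n; *-monoʳ-∣; *-cancelˡ-∣)
open import Data.Integer.DivMod using (_%ℕ_; _/ℕ_; n%ℕd<d; a≡a%ℕn+[a/ℕn]*n)
import Data.Integer.GCD as ℤ
import Data.Integer.Properties as ℤ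
open import Data.List using ([]; _∷_)
open import Data.Integer.Tactic.RingSolver using (solve-∀)
open import Data.Nat as ℕ using (ℕ; zero; suc; NonZero; z≤n; s≤s; s<s)
import Data.Nat.Coprimality as Coprime
import Data.Nat.Divisibility as ℕ
open import Data.Nat.Induction using (<-rec)
open import Data.Nat.Primality using (Prime; prime⇒nonZero; prime⇒nonTrivial; euclidsLemma)
import Data.Nat.GCD as ℕ
import Data.Nat.Properties as ℕ
open import Data.Product using (∃; ∃₂; _×_; _,_)
open import Data.Rational as ℚ using (ℚ; 1ℚ; mkℚ; toℚᵘ; ↥_; ↧_; ↧ₙ_)
import Data.Rational.Properties as ℚ
import Data.Rational.Solver as ℚ
open import Data.Rational.Unnormalised as ℚᵘ using (mkℚᵘ; *≡*)
import Data.Rational.Unnormalised.Properties as ℚᵘ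
open import Data.Sum using (_⊎_; inj₁; inj₂)
open import Relation.Binary.PropositionalEquality hiding ([_])
open import Relation.Nullary using (¬_; yes; no; contradiction)

open ≡-Reasoning

-- The embedding of the integers into the rationals

toℚᵘ-ι : ∀ a → toℚᵘ (ι a) ℚᵘ.≃ mkℚᵘ a 0
toℚᵘ-ι a = ℚ.toℚᵘ-fromℚᵘ (mkℚᵘ a 0)

ι-+ : ∀ a b → ι (a ℤ.+ b) ≡ ι a ℚ.+ ι b
ι-+ a b = ℚ.toℚᵘ-injective (ℚᵘ.≃-trans (toℚᵘ-ι (a ℤ.+ b)) (ℚᵘ.≃-trans
  (*≡* (lemma a b))
  (ℚᵘ.≃-sym (ℚᵘ.≃-trans (ℚ.toℚᵘ-homo-+ (ι a) (ι b)) (ℚᵘ.+-cong (toℚᵘ-ι a) (toℚᵘ-ι b))))))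
  where
  lemma : ∀ a b → (a ℤ.+ b) ℤ.* 1ℤ ≡ (a ℤ.* 1ℤ ℤ.+ b ℤ.* 1ℤ) ℤ.* 1ℤ
  lemma = solve-∀

ι-* : ∀ a b → ι (a ℤ.* b) ≡ ι a ℚ.* ι b
ι-* a b = ℚ.toℚᵘ-injective (ℚᵘ.≃-trans (toℚᵘ-ι (a ℤ.* b))
  (ℚᵘ.≃-sym (ℚᵘ.≃-trans (ℚ.toℚᵘ-homo-* (ι a) (ι b)) (ℚᵘ.*-cong (toℚᵘ-ι a) (toℚᵘ-ι b)))))

ι-neg : ∀ a → ι (ℤ.- a) ≡ ℚ.- ι a
ι-neg a = ℚ.toℚᵘ-injective (ℚᵘ.≃-trans (toℚᵘ-ι (ℤ.- a))
  (ℚᵘ.≃-sym (ℚᵘ.≃-trans (ℚ.toℚᵘ-homo‿- (ι a)) (ℚᵘ.-‿cong (toℚᵘ-ι a)))))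

ι-- : ∀ a b → ι (a ℤ.- b) ≡ ι a ℚ.- ι b
ι-- a b = trans (ι-+ a (ℤ.- b)) (cong (ι a ℚ.+_) (ι-neg b))

ι-injective : ∀ {a b} → ι a ≡ ι b → a ≡ b
ι-injective {a} {b} eq with ℚ.fromℚᵘ-injective {mkℚᵘ a 0} {mkℚᵘ b 0} eq
... | *≡* a*1≡b*1 = trans (sym (ℤ.*-identityʳ a)) (trans a*1≡b*1 (ℤ.*-identityʳ b))

ι-↧*q : ∀ q → ι (↧ q) ℚ.* q ≡ ι (↥ q)
ι-↧*q q@(mkℚ n d-1 _) = ℚ.toℚᵘ-injective (ℚᵘ.≃-trans (ℚ.toℚᵘ-homo-* (ι (↧ q)) q)
  (ℚᵘ.≃-trans (ℚᵘ.*-congʳ (toℚᵘ-ι (↧ q)))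
  (ℚᵘ.≃-trans (*≡* (trans (lemma (↧ q) n) (cong (λ d → n ℤ.* + suc d) (sym (ℕ.+-identityʳ d-1)))))
  (ℚᵘ.≃-sym (toℚᵘ-ι n)))))
  where
  lemma : ∀ d n → (d ℤ.* n) ℤ.* 1ℤ ≡ n ℤ.* d
  lemma = solve-∀

ι-n*[1/n] : ∀ n .{{_ : NonZero n}} → ι (+ n) ℚ.* (1ℤ ℚ./ n) ≡ 1ℚ
ι-n*[1/n] (suc k) = ℚ.toℚᵘ-injective (ℚᵘ.≃-trans (ℚ.toℚᵘ-homo-* (ι (+ suc k)) (1ℤ ℚ./ suc k))
  (ℚᵘ.≃-trans (ℚᵘ.*-cong (toℚᵘ-ι (+ suc k)) (ℚ.toℚᵘ-fromℚᵘ (mkℚᵘ 1ℤ k)))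
  (*≡* (trans (ℤ.*-identityʳ (+ suc k ℤ.* 1ℤ)) (trans (ℤ.*-identityʳ (+ suc k))
    (sym (trans (ℤ.*-identityˡ (+ (1 ℕ.* suc k))) (cong +_ (ℕ.*-identityˡ (suc k))))))))))

-- The reduced denominator times `gcd a 1` is 1. The divisibility form composes by transitivity with
-- a hypothesis that p divides the denominator.
↧ₙ-ι : ∀ a → ↧ₙ (ι a) ℕ.∣ 1
↧ₙ-ι a = ∣⇒∣ᵤ {↧ ι a} {1ℤ} (divides (ℤ.gcd a 1ℤ) (sym (trans (ℤ.*-comm _ (↧ ι a)) (ℚ.↧-/ a 1))))

coprime-↧-↥ : ∀ q → ℤ.gcd (↧ q) (ℤ.- ↥ q) ≡ 1ℤ
coprime-↧-↥ q@(mkℚ n d-1 c) = cong +_ (trans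
  (cong (ℕ.gcd (suc d-1)) (ℤ.∣-i∣≡∣i∣ n))
  (Coprime.coprime⇒gcd≡1 (Coprime.sym (Coprime.recompute c))))

-- Moves the sign of t = ±u over to b, since the quantity divided by p in each step is
-- `- signed s b`.
signed-*-swap : ∀ s b u → b ℤ.* signed s u ≡ signed s b ℤ.* u
signed-*-swap T₁ b u = refl
signed-*-swap T₂ b u = trans (sym (ℤ.neg-distribʳ-* b u)) (ℤ.neg-distribˡ-* b u)

module _ (p : ℕ) (p-prime : Prime p) where

  private
    instance
      p≢0 : NonZero p
      p≢0 = prime⇒nonZero p-prime

    infix 8 p^_
    p^_ : ℕ → ℤ
    p^ n = + (p ℕ.^ n)

  -- Divisibility by powers of p

  p^1≡p : p^ 1 ≡ + p
  p^1≡p = cong +_ (ℕ.*-identityʳ p)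

  p^-suc : ∀ n → p^ suc n ≡ + p ℤ.* p^ n
  p^-suc n = ℤ.pos-* p (p ℕ.^ n)

  1∣ : ∀ a → 1ℤ ∣ a
  1∣ a = divides a (sym (ℤ.*-identityʳ a))

  prime-∣* : ∀ a b → + p ∣ a ℤ.* b → (+ p ∣ a) ⊎ (+ p ∣ b)
  prime-∣* a b p∣ab
    with euclidsLemma ∣ a ∣ ∣ b ∣ p-prime (subst (p ℕ.∣_) (ℤ.abs-* a b) (∣⇒∣ᵤ p∣ab))
  ... | inj₁ d = inj₁ (∣ᵤ⇒∣ d)
  ... | inj₂ d = inj₂ (∣ᵤ⇒∣ d)

  -- Euclid's lemma strips one factor p from b in each of m rounds. This is how numbers prime to p,
  -- such as denominators, are inverted without leaving the integers.
  p^∣-cancelˡ : ∀ m {a b} → ¬ (+ p ∣ a) → p^ m ∣ a ℤ.* b → p^ m ∣ b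
  p^∣-cancelˡ zero    {b = b} _ _ = 1∣ b
  p^∣-cancelˡ (suc m) {a} {b} p∤a (divides q eq)
    with prime-∣* a b (divides (q ℤ.* p^ m)
           (trans eq (trans (cong (q ℤ.*_) (p^-suc m)) (lemma q (+ p) (p^ m)))))
    where
    lemma : ∀ q p r → q ℤ.* (p ℤ.* r) ≡ q ℤ.* r ℤ.* p
    lemma = solve-∀
  ... | inj₁ p∣a = contradiction p∣a p∤a
  ... | inj₂ (divides b′ refl) =
    subst₂ _∣_ (sym (p^-suc m)) (ℤ.*-comm (+ p) b′)
      (*-monoʳ-∣ (+ p) (p^∣-cancelˡ m p∤a (*-cancelˡ-∣ (+ p)
        (subst₂ _∣_ (p^-suc m) (lemma a b′ (+ p)) (divides q eq)))))
    where
    lemma : ∀ a b p → a ℤ.* (b ℤ.* p) ≡ p ℤ.* (a ℤ.* b)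
    lemma = solve-∀

  1<p : 1 ℕ.< p
  1<p = ℕ.nonTrivial⇒n>1 p {{prime⇒nonTrivial p-prime}}

  p∤1 : ¬ (p ℕ.∣ 1)
  p∤1 p∣1 = ℕ.>⇒≢ 1<p (ℕ.∣1⇒≡1 p∣1)

  -- Strong induction on the absolute value. Applied to a constant coefficient c, it yields both the
  -- valuation k and the unit part u.
  p-adic-factorisation : ∀ c → c ≢ 0ℤ → ∃₂ λ k u → c ≡ u ℤ.* p^ k × ¬ (+ p ∣ u)
  p-adic-factorisation c = <-rec Goal go ∣ c ∣ c refl
    where
    Goal : ℕ → Set
    Goal n = ∀ c → n ≡ ∣ c ∣ → c ≢ 0ℤ → ∃₂ λ k u → c ≡ u ℤ.* p^ k × ¬ (+ p ∣ u)

    go : ∀ n → (∀ {m} → m ℕ.< n → Goal m) → Goal n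
    go n rec c refl c≢0 with p ℕ.∣? ∣ c ∣
    ... | no p∤c = 0 , c , sym (ℤ.*-identityʳ c) , λ p∣c → p∤c (∣⇒∣ᵤ p∣c)
    ... | yes p∣c with ∣ᵤ⇒∣ {+ p} {c} p∣c
    ... | divides q refl = let (k , u , q≡ , p∤u) = rec q<c q refl q≢0 in
      suc k , u ,
      trans (cong (ℤ._* + p) q≡) (trans (lemma u (p^ k) (+ p)) (cong (u ℤ.*_) (sym (p^-suc k)))) ,
      p∤u
      where
      lemma : ∀ u r p → u ℤ.* r ℤ.* p ≡ u ℤ.* (p ℤ.* r)
      lemma = solve-∀
      q≢0 : q ≢ 0ℤ
      q≢0 refl = c≢0 refl
      q<c : ∣ q ∣ ℕ.< ∣ q ℤ.* + p ∣
      q<c = subst (∣ q ∣ ℕ.<_) (sym (ℤ.abs-* q (+ p)))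
        (ℕ.m<m*n ∣ q ∣ p {{ℕ.≢-nonZero λ eq → q≢0 (ℤ.∣i∣≡0⇒i≡0 eq)}} 1<p)

  -- Finite sums of p-adic digits

  digitSum : (ℕ → Fin p) → ℕ → ℤ
  digitSum e zero    = 0ℤ
  digitSum e (suc n) = digitSum e n ℤ.+ + toℕ (e n) ℤ.* p^ n

  -- The definition adds the top digit last, to agree with `partialSum`. Divisibility arguments peel
  -- off the lowest digit instead.
  digitSum-horner : ∀ e n →
    digitSum e (suc n) ≡ + toℕ (e 0) ℤ.+ + p ℤ.* digitSum (λ i → e (suc i)) n
  digitSum-horner e zero = lemma (+ toℕ (e 0)) (+ p)
    where
    lemma : ∀ a p → 0ℤ ℤ.+ a ℤ.* 1ℤ ≡ a ℤ.+ p ℤ.* 0ℤ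
    lemma = solve-∀
  digitSum-horner e (suc n) = begin
    digitSum e (suc n) ℤ.+ a ℤ.* p^ suc n
      ≡⟨ cong₂ (λ s r → s ℤ.+ a ℤ.* r) (digitSum-horner e n) (p^-suc n) ⟩
    (+ toℕ (e 0) ℤ.+ + p ℤ.* S) ℤ.+ a ℤ.* (+ p ℤ.* p^ n)
      ≡⟨ lemma (+ toℕ (e 0)) (+ p) S a (p^ n) ⟩
    + toℕ (e 0) ℤ.+ + p ℤ.* (S ℤ.+ a ℤ.* p^ n) ∎
    where
    a = + toℕ (e (suc n))
    S = digitSum (λ i → e (suc i)) n
    lemma : ∀ e₀ p S a r → (e₀ ℤ.+ p ℤ.* S) ℤ.+ a ℤ.* (p ℤ.* r) ≡ e₀ ℤ.+ p ℤ.* (S ℤ.+ a ℤ.* r)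
    lemma = solve-∀

  -- Modulo p only the lowest digit survives, and a digit below p that p divides is 0. The remaining
  -- sum is divided by p and the argument repeats. The bound m ≤ n ensures that every digit in
  -- question occurs in the sum.
  p^∣digitSum⇒digits≡0 : ∀ m n e → m ℕ.≤ n → p^ m ∣ digitSum e n →
                         ∀ i → i ℕ.< m → toℕ (e i) ≡ 0
  p^∣digitSum⇒digits≡0 (suc m) (suc n) e (s≤s m≤n) d = digits
    where
    S = digitSum (λ i → e (suc i)) n
    p∣p^ : + p ∣ p^ suc m
    p∣p^ = divides (p^ m) (trans (p^-suc m) (ℤ.*-comm (+ p) (p^ m)))
    d′ : p^ suc m ∣ + toℕ (e 0) ℤ.+ + p ℤ.* S
    d′ = subst (p^ suc m ∣_) (digitSum-horner e n) d
    e₀≡0 : toℕ (e 0) ≡ 0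
    e₀≡0 with toℕ (e 0) | Fin.toℕ<n (e 0)
            | ∣⇒∣ᵤ {+ p} (∣m+n∣n⇒∣m {m = + toℕ (e 0)} (∣-trans p∣p^ d′) (∣m⇒∣m*n S ∣-refl))
    ... | zero  | _   | _  = refl
    ... | suc a | a<p | p∣a = contradiction p∣a (ℕ.>⇒∤ a<p)
    d″ : p^ m ∣ S
    d″ = *-cancelˡ-∣ (+ p) (subst₂ _∣_ (p^-suc m)
      (trans (cong (λ a → + a ℤ.+ + p ℤ.* S) e₀≡0) (ℤ.+-identityˡ _)) d′)
    digits : ∀ i → i ℕ.< suc m → toℕ (e i) ≡ 0
    digits zero    _         = e₀≡0
    digits (suc i) (s<s i<m) = p^∣digitSum⇒digits≡0 m n (λ i → e (suc i)) m≤n d″ i i<m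

  digits≡0⇒p^∣digitSum : ∀ m n e → (∀ i → i ℕ.< m → toℕ (e i) ≡ 0) → p^ m ∣ digitSum e n
  digits≡0⇒p^∣digitSum zero    n       e _  = 1∣ _
  digits≡0⇒p^∣digitSum (suc m) zero    e _  = divides 0ℤ refl
  digits≡0⇒p^∣digitSum (suc m) (suc n) e e≡0 = subst₂ _∣_ (sym (p^-suc m))
    (sym (trans (digitSum-horner e n)
      (trans (cong (λ a → + a ℤ.+ + p ℤ.* S) (e≡0 0 (s≤s z≤n))) (ℤ.+-identityˡ _))))
    (*-monoʳ-∣ (+ p) (digits≡0⇒p^∣digitSum m n (λ i → e (suc i)) λ i i<m → e≡0 (suc i) (s<s i<m)))
    where S = digitSum (λ i → e (suc i)) n

  -- Valuations and null sequences in terms of integer divisibility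

  pow*pow⁻¹ : ∀ m → pow p p-prime (+ m) ℚ.* pow p p-prime (ℤ.- (+ m)) ≡ 1ℚ
  pow*pow⁻¹ zero    = refl
  pow*pow⁻¹ (suc m) = ι-n*[1/n] (p ℕ.^ suc m) {{ℕ.m^n≢0 p (suc m)}}

  p^∣⇒Valuation≥ : ∀ m a → p^ m ∣ a → Valuation≥ p p-prime (+ m) (ι a)
  p^∣⇒Valuation≥ m a (divides q refl) p∣d =
    p∤1 (ℕ.∣-trans (subst (λ r → p ℕ.∣ ↧ₙ r) quotient p∣d) (↧ₙ-ι q))
    where
    quotient : ι (q ℤ.* p^ m) ℚ.* pow p p-prime (ℤ.- (+ m)) ≡ ι q
    quotient = begin
      ι (q ℤ.* p^ m) ℚ.* pow p p-prime (ℤ.- (+ m))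
        ≡⟨ cong (ℚ._* pow p p-prime (ℤ.- (+ m))) (ι-* q (p^ m)) ⟩
      ι q ℚ.* ι (p^ m) ℚ.* pow p p-prime (ℤ.- (+ m))
        ≡⟨ ℚ.*-assoc (ι q) (ι (p^ m)) (pow p p-prime (ℤ.- (+ m))) ⟩
      ι q ℚ.* (ι (p^ m) ℚ.* pow p p-prime (ℤ.- (+ m)))
        ≡⟨ cong (ι q ℚ.*_) (pow*pow⁻¹ m) ⟩
      ι q ℚ.* 1ℚ
        ≡⟨ ℚ.*-identityʳ (ι q) ⟩
      ι q ∎

  -- Let r = (s - q) / p^m. Clearing denominators gives `↧ r` (`↧ q` s - `↥ q`) = `↧ q` `↥ r` p^m,
  -- and `↧ r` is prime to p by hypothesis, so it can be cancelled.
  Valuation≥⇒p^∣ : ∀ m s q → Valuation≥ p p-prime (+ m) (ι s ℚ.- q) →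
                    p^ m ∣ ↧ q ℤ.* s ℤ.+ (ℤ.- ↥ q)
  Valuation≥⇒p^∣ m s q v =
    p^∣-cancelˡ m {↧ r} (λ p∣↧r → v (∣⇒∣ᵤ p∣↧r)) (divides (↧ q ℤ.* ↥ r) (ι-injective (begin
      ι (↧ r ℤ.* (↧ q ℤ.* s ℤ.+ (ℤ.- ↥ q)))
        ≡⟨ trans (ι-* (↧ r) (↧ q ℤ.* s ℤ.+ (ℤ.- ↥ q))) (cong (ι (↧ r) ℚ.*_) (trans (ι-- (↧ q ℤ.* s) (↥ q))
             (cong₂ ℚ._-_ (ι-* (↧ q) s) (sym (ι-↧*q q))))) ⟩
      ι (↧ r) ℚ.* (ι (↧ q) ℚ.* ι s ℚ.- ι (↧ q) ℚ.* q)
        -- The trailing factor 1 is a placeholder, replaced next by p^m times its inverse.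
        ≡⟨ ℚ.+-*-Solver.solve 4 (λ R Q S q → R :* (Q :* S :- Q :* q) := Q :* R :* (S :- q) :* con 1ℚ)
             refl (ι (↧ r)) (ι (↧ q)) (ι s) q ⟩
      ι (↧ q) ℚ.* ι (↧ r) ℚ.* (ι s ℚ.- q) ℚ.* 1ℚ
        ≡⟨ cong (ι (↧ q) ℚ.* ι (↧ r) ℚ.* (ι s ℚ.- q) ℚ.*_) (sym (pow*pow⁻¹ m)) ⟩
      ι (↧ q) ℚ.* ι (↧ r) ℚ.* (ι s ℚ.- q) ℚ.* (ι (p^ m) ℚ.* w)
        ≡⟨ ℚ.+-*-Solver.solve 5 (λ Q R d P w → Q :* R :* d :* (P :* w) := Q :* (R :* (d :* w)) :* P)
             refl (ι (↧ q)) (ι (↧ r)) (ι s ℚ.- q) (ι (p^ m)) w ⟩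
      ι (↧ q) ℚ.* (ι (↧ r) ℚ.* r) ℚ.* ι (p^ m)
        ≡⟨ cong (λ a → ι (↧ q) ℚ.* a ℚ.* ι (p^ m)) (ι-↧*q r) ⟩
      ι (↧ q) ℚ.* ι (↥ r) ℚ.* ι (p^ m)
        ≡⟨ sym (trans (ι-* (↧ q ℤ.* ↥ r) (p^ m)) (cong (ℚ._* ι (p^ m)) (ι-* (↧ q) (↥ r)))) ⟩
      ι (↧ q ℤ.* ↥ r ℤ.* p^ m) ∎)))
    where
    open ℚ.+-*-Solver using (_:*_; _:-_; _:=_; con)
    w = pow p p-prime (ℤ.- (+ m))
    r = (ι s ℚ.- q) ℚ.* w

  -- Expansions that start at index 0 have integer partial sums, so for them p-adic convergence to 0
  -- can be handled by divisibility alone.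
  Nullℤ : (ℕ → ℤ) → Set
  Nullℤ f = ∀ m → ∃ λ N → ∀ n → N ℕ.≤ n → p^ m ∣ f n

  Nullℤ⇒Null : ∀ {f g} → (∀ n → g n ≡ ι (f n)) → Nullℤ f → Null p p-prime g
  Nullℤ⇒Null {f} g≡ f→0 m = let (N , d) = f→0 m in
    N , λ n N≤n → subst (Valuation≥ p p-prime (+ m)) (sym (g≡ n)) (p^∣⇒Valuation≥ m (f n) (d n N≤n))

  -- Partial sums of p-adic numbers

  digits⁺ : ℚₚ p p-prime → ℕ → Fin p
  digits⁺ x i = digit x (+ i)

  truncate : ℚₚ p p-prime → ℕ → ℤ
  truncate x n = digitSum (digits⁺ x) (suc n)

  module _ (x : ℚₚ p p-prime) where

    private
      summand : ℕ → ℕ → ℚ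
      summand s j = ι (+ toℕ (digit x (j ⊖ s))) ℚ.* pow p p-prime (j ⊖ s)

    Σ≡digitSum : ∀ n → Σ[< n ] (summand 0) ≡ ι (digitSum (digits⁺ x) n)
    Σ≡digitSum zero    = refl
    Σ≡digitSum (suc n) = sym (trans (ι-+ (digitSum (digits⁺ x) n) _)
      (cong₂ ℚ._+_ (sym (Σ≡digitSum n)) (ι-* (+ toℕ (digits⁺ x n)) (p^ n))))

    partialSum≡truncate : start x ≡ 0 → ∀ n → partialSum p p-prime x n ≡ ι (truncate x n)
    partialSum≡truncate s≡0 n =
      trans (cong (λ s → Σ[< s ℕ.+ suc n ] (summand s)) s≡0) (Σ≡digitSum (suc n))

    partialSum-⟨⟩ : ∀ n → partialSum p p-prime x n ≡
      [_] p p-prime x ℚ.+ ι (truncate (⟨_⟩ p p-prime x) n)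
    -- The fractional part has digit 0 at index 0, so its truncation there vanishes.
    partialSum-⟨⟩ zero = sym (trans
      (cong (λ a → [_] p p-prime x ℚ.+ ι (0ℤ ℤ.+ + a ℤ.* 1ℤ)) (Fin.toℕ-fromℕ< (ℕ.>-nonZero⁻¹ p)))
      (ℚ.+-identityʳ _))
    partialSum-⟨⟩ (suc n) = begin
      Σ[< s ℕ.+ suc (suc n) ] (summand s)
        ≡⟨ cong (λ k → Σ[< k ] (summand s)) (ℕ.+-suc s (suc n)) ⟩
      partialSum p p-prime x n ℚ.+ summand s (s ℕ.+ suc n)
        ≡⟨ cong₂ ℚ._+_ (partialSum-⟨⟩ n)
             (trans (cong (λ i → ι (+ toℕ (digit x i)) ℚ.* pow p p-prime i) index)
                    (sym (ι-* (+ toℕ (digits⁺ x (suc n))) (p^ suc n)))) ⟩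
      [_] p p-prime x ℚ.+ ι T ℚ.+ ι t
        ≡⟨ ℚ.+-assoc ([_] p p-prime x) (ι T) (ι t) ⟩
      [_] p p-prime x ℚ.+ (ι T ℚ.+ ι t)
        ≡⟨ cong ([_] p p-prime x ℚ.+_) (sym (ι-+ T t)) ⟩
      [_] p p-prime x ℚ.+ ι (T ℤ.+ t) ∎
      where
      s = start x
      T = truncate (⟨_⟩ p p-prime x) n
      t = + toℕ (digits⁺ x (suc n)) ℤ.* p^ suc n
      index : (s ℕ.+ suc n) ⊖ s ≡ + suc n
      index = trans (ℤ.⊖-≥ (ℕ.m≤m+n s (suc n))) (cong +_ (ℕ.m+n∸m≡n s (suc n)))

  -- The p-adic expansion of an integer

  zeroDigit : Fin p
  zeroDigit = Fin.fromℕ< (ℕ.>-nonZero⁻¹ p)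

  -- Iterated division with nonnegative remainder. It covers negative integers as well: for -1 the
  -- quotient is again -1 and every digit is p - 1.
  ℤdigit : ℤ → ℕ → Fin p
  ℤdigit a zero    = Fin.fromℕ< (n%ℕd<d a p)
  ℤdigit a (suc i) = ℤdigit (a /ℕ p) i

  fromℤ : ℤ → ℚₚ p p-prime
  fromℤ a = record { digit = d ; start = 0 ; bounded = d-bounded }
    where
    d : ℤ → Fin p
    d (+ i)    = ℤdigit a i
    d -[1+ _ ] = zeroDigit
    d-bounded : ∀ i → i ℤ.< 0ℤ → toℕ (d i) ≡ 0
    d-bounded -[1+ _ ] _ = Fin.toℕ-fromℕ< (ℕ.>-nonZero⁻¹ p)
    d-bounded (+ _) (ℤ.+<+ ())

  -- Subtracting the Horner form from a = r + qp cancels the remainder r and leaves p times the same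
  -- difference for the quotient q.
  digitSum-ℤdigit : ∀ m n a → m ℕ.≤ n → p^ m ∣ a ℤ.- digitSum (ℤdigit a) n
  digitSum-ℤdigit zero    n       a _         = 1∣ _
  digitSum-ℤdigit (suc m) (suc n) a (s≤s m≤n) = subst₂ _∣_ (sym (p^-suc m)) (sym eq)
    (*-monoʳ-∣ (+ p) (digitSum-ℤdigit m n (a /ℕ p) m≤n))
    where
    S = digitSum (ℤdigit (a /ℕ p)) n
    lemma : ∀ r q p S → (r ℤ.+ q ℤ.* p) ℤ.- (r ℤ.+ p ℤ.* S) ≡ p ℤ.* (q ℤ.- S)
    lemma = solve-∀
    eq : a ℤ.- digitSum (ℤdigit a) (suc n) ≡ + p ℤ.* (a /ℕ p ℤ.- S)
    eq = trans (cong₂ ℤ._-_ (a≡a%ℕn+[a/ℕn]*n a p) (trans (digitSum-horner (ℤdigit a) n)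
           (cong (λ r → + r ℤ.+ + p ℤ.* S) (Fin.toℕ-fromℕ< (n%ℕd<d a p)))))
         (lemma (+ (a %ℕ p)) (a /ℕ p) (+ p) S)

  -- Rational elements of the maximal ideal

  -- x ∈ pℤₚ is the rational number -c/b in lowest terms.
  record Represents (x : ℚₚ p p-prime) (b c : ℤ) : Set where
    field
      start≡0 : start x ≡ 0
      x∈pℤₚ   : InMaximalIdeal p p-prime x
      0<b     : 0ℤ ℤ.< b
      coprime : ℤ.gcd b c ≡ 1ℤ
      root    : Nullℤ λ n → b ℤ.* truncate x n ℤ.+ c

    p∣truncate : ∀ n → + p ∣ truncate x n
    p∣truncate n = subst (_∣ truncate x n) p^1≡p
      (digits≡0⇒p^∣digitSum 1 (suc n) (digits⁺ x) λ { zero _ → x∈pℤₚ 0ℤ ℤ.≤-refl ; (suc _) (s≤s ()) })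

    -- Modulo p, bx + c vanishes and so does x.
    p∣c : + p ∣ c
    p∣c = let (N , d) = root 1 in
      ∣m+n∣m⇒∣n (subst (_∣ b ℤ.* truncate x N ℤ.+ c) p^1≡p (d N ℕ.≤-refl))
        (∣n⇒∣m*n b (p∣truncate N))

    p∤b : ¬ (+ p ∣ b)
    p∤b p∣b = p∤1 (subst (p ℕ.∣_) (ℤ.+-injective coprime)
      (ℕ.gcd-greatest (∣⇒∣ᵤ p∣b) (∣⇒∣ᵤ p∣c)))

    -- Since b is prime to p, x = -c/b and c have the same valuation. This is one half of that fact
    -- and `digits≡0⇒p^∣c` is the other.
    p^∣c⇒digits≡0 : ∀ m → p^ m ∣ c → ∀ i → i ℕ.< m → toℕ (digits⁺ x i) ≡ 0
    p^∣c⇒digits≡0 m p^∣c =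
      -- The index n must be late enough for the root congruence modulo p^m, and large enough for
      -- the sum to contain all digits below m.
      let (N , d) = root m ; n = N ℕ.⊔ m in
      p^∣digitSum⇒digits≡0 m (suc n) (digits⁺ x) (ℕ.m≤n⇒m≤1+n (ℕ.m≤n⊔m N m))
        (p^∣-cancelˡ m p∤b (∣m+n∣n⇒∣m (d n (ℕ.m≤m⊔n N m)) p^∣c))

    digits≡0⇒p^∣c : ∀ m → (∀ i → i ℕ.< m → toℕ (digits⁺ x i) ≡ 0) → p^ m ∣ c
    digits≡0⇒p^∣c m x≡0 = let (N , d) = root m in
      ∣m+n∣m⇒∣n (d N ℕ.≤-refl) (∣n⇒∣m*n b (digits≡0⇒p^∣digitSum m (suc N) (digits⁺ x) x≡0))

  represents-fromℤ : ∀ z → Represents (fromℤ (+ p ℤ.* z)) 1ℤ (ℤ.- (+ p ℤ.* z))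
  represents-fromℤ z = record
    { start≡0 = refl
    ; x∈pℤₚ   = in-ideal
    ; 0<b     = ℤ.+<+ (s≤s z≤n)
    ; coprime = cong +_ (ℕ.∣1⇒≡1 (ℕ.gcd[m,n]∣m 1 ∣ ℤ.- (+ p ℤ.* z) ∣))
    ; root    = λ m → m , λ n m≤n → subst (p^ m ∣_) (lemma (+ p ℤ.* z) _)
                  (∣m⇒∣-m (digitSum-ℤdigit m (suc n) (+ p ℤ.* z) (ℕ.m≤n⇒m≤1+n m≤n)))
    }
    where
    lemma : ∀ a s → ℤ.- (a ℤ.- s) ≡ 1ℤ ℤ.* s ℤ.+ (ℤ.- a)
    lemma = solve-∀
    lemma′ : ∀ a s → ℤ.- (a ℤ.- s) ≡ ℤ.- a ℤ.+ s
    lemma′ = solve-∀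
    in-ideal : InMaximalIdeal p p-prime (fromℤ (+ p ℤ.* z))
    -- The one-digit sum S is congruent to pz modulo p, hence divisible by p.
    in-ideal (+ zero) _ = p^∣digitSum⇒digits≡0 1 1 (ℤdigit (+ p ℤ.* z)) ℕ.≤-refl
      (subst (_∣ S) (sym p^1≡p) (∣m+n∣m⇒∣n {m = ℤ.- (+ p ℤ.* z)}
        (subst₂ _∣_ p^1≡p (lemma′ (+ p ℤ.* z) S)
          (∣m⇒∣-m (digitSum-ℤdigit 1 1 (+ p ℤ.* z) ℕ.≤-refl)))
        (∣m⇒∣-m (∣m⇒∣m*n z ∣-refl)))) 0 (s≤s z≤n)
      where
      S = digitSum (ℤdigit (+ p ℤ.* z)) 1
    in-ideal (+ suc _) (ℤ.+≤+ ())
    in-ideal -[1+ _ ] _ = Fin.toℕ-fromℕ< (ℕ.>-nonZero⁻¹ p)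

  -- One step of the algorithm on a rational number

  linear-minimal : ∀ {x b c} → Represents x b c → IsMinimalPolynomial p p-prime (linear b c) x
  linear-minimal {x} {b} {c} x≈ = record
    { root         = Nullℤ⇒Null eq root
    ; lowestDegree = λ b≡0 → ℤ.<⇒≢ 0<b (sym b≡0)
    ; positive     = 0<b
    ; coprime      = coprime
    }
    where
    open Represents x≈
    eq : ∀ n → eval (linear b c) (partialSum p p-prime x n) ≡ ι (b ℤ.* truncate x n ℤ.+ c)
    eq n = begin
      ι b ℚ.* partialSum p p-prime x n ℚ.+ ι c
        ≡⟨ cong (λ s → ι b ℚ.* s ℚ.+ ι c) (partialSum≡truncate x start≡0 n) ⟩
      ι b ℚ.* ι (truncate x n) ℚ.+ ι c
        ≡⟨ sym (trans (ι-+ (b ℤ.* truncate x n) c) (cong (ℚ._+ ι c) (ι-* b (truncate x n)))) ⟩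
      ι (b ℤ.* truncate x n ℤ.+ c) ∎

  -- Every power of p divides 0, so every digit vanishes.
  represents-0⇒IsZero : ∀ {x b} → Represents x b 0ℤ → IsZero p p-prime x
  represents-0⇒IsZero x≈ (+ i) =
    Represents.p^∣c⇒digits≡0 x≈ (suc i) (divides 0ℤ refl) i ℕ.≤-refl
  represents-0⇒IsZero x≈ -[1+ i ] = Represents.x∈pℤₚ x≈ -[1+ i ] ℤ.-≤+

  -- With c = u p^k and x = -c/b, the quotient t p^k / x equals `- signed σ b`, where σ is the
  -- chosen branch. Splitting it as d + pz with 1 ≤ d < p makes d the partial denominator and pz the
  -- image of x.
  step-linear : ∀ alg {x b c} → Represents x b c → c ≢ 0ℤ → ∀ d z → 1 ℕ.≤ d → d ℕ.< p →
    ℤ.- signed (branch alg (linear b c)) b ≡ + d ℤ.+ + p ℤ.* z →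
    ∃ λ τ → Step p p-prime alg x τ (fromℤ (+ p ℤ.* z))
  step-linear alg {x} {b} {c} x≈ c≢0 d z 1≤d d<p -sb≡ with p-adic-factorisation c c≢0
  ... | k , u , c≡ , p∤u = term (signed σ u) (+ k) d , record
    { x∈pℤₚ     = x∈pℤₚ
    ; minPoly   = linear b c
    ; isMinimal = linear-minimal x≈
    ; u         = u
    ; unitPart  = record
      { v       = k
      ; divides = ∣⇒∣ᵤ p^k∣c
      ; exact   = λ p^∣c → p^1+k∤c (∣ᵤ⇒∣ p^∣c)
      ; value   = sym unit-value
      }
    ; valuation = digit-k≢0 , digits<k
    ; t-value   = refl
    ; d-lower   = 1≤d
    ; d-upper   = d<p
    ; y∈pℤₚ     = Represents.x∈pℤₚ y≈
    ; equation  = Nullℤ⇒Null rational-residue residue→0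
    }
    where
    open Represents x≈
    σ = branch alg (linear b c)
    y = fromℤ (+ p ℤ.* z)
    y≈ = represents-fromℤ z

    p^k∣c : p^ k ∣ c
    p^k∣c = divides u c≡

    p^1+k∤c : ¬ (p^ suc k ∣ c)
    p^1+k∤c d = p∤u (*-cancelˡ-∣ (p^ k) {{ℕ.m^n≢0 p k}}
      (subst₂ _∣_ (trans (p^-suc k) (ℤ.*-comm (+ p) (p^ k))) (trans c≡ (ℤ.*-comm u (p^ k))) d))

    unit-value : ι c ℚ.* pow p p-prime (ℤ.- (+ k)) ≡ ι u
    unit-value = begin
      ι c ℚ.* w                ≡⟨ cong (λ a → ι a ℚ.* w) c≡ ⟩
      ι (u ℤ.* p^ k) ℚ.* w     ≡⟨ cong (ℚ._* w) (ι-* u (p^ k)) ⟩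
      ι u ℚ.* ι (p^ k) ℚ.* w   ≡⟨ ℚ.*-assoc (ι u) (ι (p^ k)) w ⟩
      ι u ℚ.* (ι (p^ k) ℚ.* w) ≡⟨ cong (ι u ℚ.*_) (pow*pow⁻¹ k) ⟩
      ι u ℚ.* 1ℚ               ≡⟨ ℚ.*-identityʳ (ι u) ⟩
      ι u ∎
      where w = pow p p-prime (ℤ.- (+ k))

    digits<k : ∀ i → i ℤ.< + k → toℕ (digit x i) ≡ 0
    digits<k (+ i)    (ℤ.+<+ i<k) = p^∣c⇒digits≡0 k p^k∣c i i<k
    digits<k -[1+ i ] _           = x∈pℤₚ -[1+ i ] ℤ.-≤+

    digit-k≢0 : toℕ (digit x (+ k)) ≢ 0
    -- If digit k vanished too, p^(k+1) would divide c, contrary to the choice of u.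
    digit-k≢0 x_k≡0 = p^1+k∤c (digits≡0⇒p^∣c (suc k) digits≤k)
      where
      digits≤k : ∀ i → i ℕ.< suc k → toℕ (digits⁺ x i) ≡ 0
      digits≤k i i<1+k with ℕ.m<1+n⇒m<n∨m≡n i<1+k
      ... | inj₁ i<k  = digits<k (+ i) (ℤ.+<+ i<k)
      ... | inj₂ refl = x_k≡0

    residue : ℕ → ℤ
    residue n = (truncate y n ℤ.+ + d) ℤ.* truncate x n ℤ.- signed σ u ℤ.* p^ k

    -- Multiplied by b, the residue of the step equation becomes a combination of bX + c and Y - pz,
    -- which tend to 0 because X and Y approximate x and y. As p does not divide b, the residue
    -- itself tends to 0.
    b*residue : ∀ n → b ℤ.* residue n ≡
      (truncate y n ℤ.+ + d) ℤ.* (b ℤ.* truncate x n ℤ.+ c)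
        ℤ.- c ℤ.* (1ℤ ℤ.* truncate y n ℤ.+ (ℤ.- (+ p ℤ.* z)))
    b*residue n = begin
      b ℤ.* ((Y ℤ.+ D) ℤ.* X ℤ.- signed σ u ℤ.* p^ k)
        ≡⟨ lemma₁ b (Y ℤ.+ D) X (signed σ u) (p^ k) ⟩
      b ℤ.* ((Y ℤ.+ D) ℤ.* X) ℤ.- b ℤ.* signed σ u ℤ.* p^ k
        ≡⟨ cong (λ a → b ℤ.* ((Y ℤ.+ D) ℤ.* X) ℤ.- a ℤ.* p^ k) (signed-*-swap σ b u) ⟩
      b ℤ.* ((Y ℤ.+ D) ℤ.* X) ℤ.- signed σ b ℤ.* u ℤ.* p^ k
        ≡⟨ lemma₂ b (Y ℤ.+ D) X (signed σ b) u (p^ k) ⟩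
      b ℤ.* ((Y ℤ.+ D) ℤ.* X) ℤ.+ (ℤ.- signed σ b) ℤ.* (u ℤ.* p^ k)
        ≡⟨ cong₂ (λ s c → b ℤ.* ((Y ℤ.+ D) ℤ.* X) ℤ.+ s ℤ.* c) -sb≡ (sym c≡) ⟩
      b ℤ.* ((Y ℤ.+ D) ℤ.* X) ℤ.+ (D ℤ.+ + p ℤ.* z) ℤ.* c
        ≡⟨ lemma₃ b Y D X (+ p ℤ.* z) c ⟩
      (Y ℤ.+ D) ℤ.* (b ℤ.* X ℤ.+ c) ℤ.- c ℤ.* (1ℤ ℤ.* Y ℤ.+ (ℤ.- (+ p ℤ.* z))) ∎
      where
      X = truncate x n
      Y = truncate y n
      D = + d
      lemma₁ : ∀ b Y X s r → b ℤ.* (Y ℤ.* X ℤ.- s ℤ.* r) ≡ b ℤ.* (Y ℤ.* X) ℤ.- b ℤ.* s ℤ.* r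
      lemma₁ = solve-∀
      lemma₂ : ∀ b Y X s u r → b ℤ.* (Y ℤ.* X) ℤ.- s ℤ.* u ℤ.* r ≡
               b ℤ.* (Y ℤ.* X) ℤ.+ (ℤ.- s) ℤ.* (u ℤ.* r)
      lemma₂ = solve-∀
      lemma₃ : ∀ b Y D X w c → b ℤ.* ((Y ℤ.+ D) ℤ.* X) ℤ.+ (D ℤ.+ w) ℤ.* c ≡
               (Y ℤ.+ D) ℤ.* (b ℤ.* X ℤ.+ c) ℤ.- c ℤ.* (1ℤ ℤ.* Y ℤ.+ (ℤ.- w))
      lemma₃ = solve-∀

    residue→0 : Nullℤ residue
    residue→0 m with root m | Represents.root y≈ m
    ... | M , x-root | N , y-root = M ℕ.⊔ N , λ n n≥ → p^∣-cancelˡ m p∤b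
      (subst (p^ m ∣_) (sym (b*residue n)) (∣m∣n⇒∣m-n
        (∣n⇒∣m*n (truncate y n ℤ.+ + d) (x-root n (ℕ.m⊔n≤o⇒m≤o M N n≥)))
        (∣n⇒∣m*n c (y-root n (ℕ.m⊔n≤o⇒n≤o M N n≥)))))

    rational-residue : ∀ n →
      (partialSum p p-prime y n ℚ.+ ι (+ d)) ℚ.* partialSum p p-prime x n
        ℚ.- ι (signed σ u) ℚ.* pow p p-prime (+ k) ≡ ι (residue n)
    rational-residue n = sym (begin
      ι ((Y ℤ.+ + d) ℤ.* X ℤ.- signed σ u ℤ.* p^ k)
        ≡⟨ ι-- ((Y ℤ.+ + d) ℤ.* X) (signed σ u ℤ.* p^ k) ⟩
      ι ((Y ℤ.+ + d) ℤ.* X) ℚ.- ι (signed σ u ℤ.* p^ k)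
        ≡⟨ cong₂ ℚ._-_ (ι-* (Y ℤ.+ + d) X) (ι-* (signed σ u) (p^ k)) ⟩
      ι (Y ℤ.+ + d) ℚ.* ι X ℚ.- ι (signed σ u) ℚ.* ι (p^ k)
        ≡⟨ cong (λ a → a ℚ.* ι X ℚ.- ι (signed σ u) ℚ.* ι (p^ k)) (ι-+ Y (+ d)) ⟩
      (ι Y ℚ.+ ι (+ d)) ℚ.* ι X ℚ.- ι (signed σ u) ℚ.* ι (p^ k)
        ≡⟨ cong₂ (λ Y X → (Y ℚ.+ ι (+ d)) ℚ.* X ℚ.- ι (signed σ u) ℚ.* ι (p^ k))
             (sym (partialSum≡truncate y refl n)) (sym (partialSum≡truncate x start≡0 n)) ⟩
      (partialSum p p-prime y n ℚ.+ ι (+ d)) ℚ.* partialSum p p-prime x n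
        ℚ.- ι (signed σ u) ℚ.* ι (p^ k) ∎)
      where
      X = truncate x n
      Y = truncate y n

  -- Finiteness of orbits

  FiniteOrbit : Algorithm → ℚₚ p p-prime → Set
  FiniteOrbit alg x = ∃ λ τs → Orbit p p-prime alg x τs

  prepend : ∀ {alg x y} → (∃ λ τ → Step p p-prime alg x τ y) →
            FiniteOrbit alg y → FiniteOrbit alg x
  prepend (τ , s) (τs , o) = τ ∷ τs , step s o

  orbit-fromℤ-0 : ∀ alg → FiniteOrbit alg (fromℤ (+ p ℤ.* 0ℤ))
  orbit-fromℤ-0 alg = [] , stop (represents-0⇒IsZero
    (subst (Represents (fromℤ (+ p ℤ.* 0ℤ)) 1ℤ) (cong ℤ.-_ (ℤ.*-zeroʳ (+ p))) (represents-fromℤ 0ℤ)))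

  -p*z≢0 : ∀ z → z ≢ 0ℤ → ℤ.- (+ p ℤ.* z) ≢ 0ℤ
  -p*z≢0 z z≢0 eq with ℤ.i*j≡0⇒i≡0∨j≡0 (+ p) {z} (ℤ.neg-injective {+ p ℤ.* z} {0ℤ} eq)
  ... | inj₁ p≡0 = ℕ.≢-nonZero⁻¹ p (ℤ.+-injective p≡0)
  ... | inj₂ z≡0 = z≢0 z≡0

  orbit-fromℤ-T₂ : ∀ alg z → z ≢ 0ℤ → branch alg (linear 1ℤ (ℤ.- (+ p ℤ.* z))) ≡ T₂ →
    FiniteOrbit alg (fromℤ (+ p ℤ.* z))
  orbit-fromℤ-T₂ alg z z≢0 br≡T₂ = prepend
    -- Here b = 1 and the branch is `T₂`, so the number to split is 1 = 1 + p · 0.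
    (step-linear alg (represents-fromℤ z) (-p*z≢0 z z≢0) 1 0ℤ ℕ.≤-refl 1<p
      (trans (cong (λ s → ℤ.- signed s 1ℤ) br≡T₂) (cong (λ a → 1ℤ ℤ.+ a) (sym (ℤ.*-zeroʳ (+ p))))))
    (orbit-fromℤ-0 alg)

  branch-T₂ : ∀ alg c → 0ℤ ℤ.< c → branch alg (linear 1ℤ c) ≡ T₂
  branch-T₂ A c 0<c = refl
  branch-T₂ B c 0<c = refl
  branch-T₂ C c 0<c with 0ℤ ℤ.<? c
  ... | yes _  = refl
  ... | no 0≮c = contradiction 0<c 0≮c

  orbit-fromℤ-neg : ∀ alg n → FiniteOrbit alg (fromℤ (+ p ℤ.* -[1+ n ]))
  -- For a negative integer y the constant term -y of X - y is positive, which is what Algorithm C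
  -- tests.
  orbit-fromℤ-neg alg n = orbit-fromℤ-T₂ alg -[1+ n ] (λ ()) (branch-T₂ alg _
    (subst (0ℤ ℤ.<_) (sym (trans (ℤ.neg-distribʳ-* (+ p) -[1+ n ]) (sym (ℤ.pos-* p (suc n)))))
      (ℤ.+<+ (ℕ.>-nonZero⁻¹ (p ℕ.* suc n) {{ℕ.m*n≢0 p (suc n)}}))))

  orbit-fromℤ : ∀ alg z → FiniteOrbit alg (fromℤ (+ p ℤ.* z))
  orbit-fromℤ alg (+ zero)  = orbit-fromℤ-0 alg
  orbit-fromℤ alg -[1+ n ]  = orbit-fromℤ-neg alg n
  -- Only Algorithm C takes the `T₁` branch here, but splitting on the branch treats all algorithms
  -- at once.
  orbit-fromℤ alg z@(+ suc n) with branch alg (linear 1ℤ (ℤ.- (+ p ℤ.* z))) in br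
  ... | T₂ = orbit-fromℤ-T₂ alg z (λ ()) br
  ... | T₁ = prepend
    -- The number to split is -1 = (p - 1) + p · (-1), so the next iterate is -p, the negative case
    -- with index 0.
    (step-linear alg (represents-fromℤ z) (-p*z≢0 z λ ()) (ℕ.pred p) ℤ.-1ℤ
      (ℕ.≤-pred (subst (2 ℕ.≤_) (sym (ℕ.suc-pred p)) 1<p)) (ℕ.≤-reflexive (ℕ.suc-pred p))
      (trans (cong (λ s → ℤ.- signed s 1ℤ) br)
        (trans (lemma (+ ℕ.pred p)) (cong (λ q → + ℕ.pred p ℤ.+ + q ℤ.* ℤ.-1ℤ) (ℕ.suc-pred p)))))
    (orbit-fromℤ-neg alg 0)
    where
    lemma : ∀ q → ℤ.-1ℤ ≡ q ℤ.+ (1ℤ ℤ.+ q) ℤ.* ℤ.-1ℤ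
    lemma = solve-∀

  orbit-rational : ∀ alg {x b c} → Represents x b c → FiniteOrbit alg x
  orbit-rational alg {x} {b} {c} x≈ with c ℤ.≟ 0ℤ
  ... | yes refl = [] , stop (represents-0⇒IsZero x≈)
  ... | no c≢0 = prepend
    -- Here d and z are the remainder and quotient of `- signed σ b` by p. The remainder is nonzero
    -- because p does not divide b.
    (step-linear alg x≈ c≢0 d z (ℕ.n≢0⇒n>0 d≢0) (n%ℕd<d β p) β≡)
    (orbit-fromℤ alg z)
    where
    σ = branch alg (linear b c)
    β = ℤ.- signed σ b
    d = β %ℕ p
    z = β /ℕ p
    β≡ : β ≡ + d ℤ.+ + p ℤ.* z
    β≡ = trans (a≡a%ℕn+[a/ℕn]*n β p) (cong (λ a → + d ℤ.+ a) (ℤ.*-comm z (+ p)))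
    p∤β : ∀ s → ¬ (+ p ∣ ℤ.- signed s b)
    p∤β T₁ p∣β = Represents.p∤b x≈ (subst (+ p ∣_) (ℤ.neg-involutive b) (∣m⇒∣-m p∣β))
    p∤β T₂ p∣β = Represents.p∤b x≈ (subst (+ p ∣_) (ℤ.neg-involutive b) p∣β)
    d≢0 : d ≢ 0
    d≢0 d≡0 = p∤β σ (divides z (trans β≡ (trans (cong (λ d → + d ℤ.+ + p ℤ.* z) d≡0)
      (trans (ℤ.+-identityˡ (+ p ℤ.* z)) (ℤ.*-comm (+ p) z)))))

  -- Removing the integral part from both sides of x = α shows that the fractional part is q = α -
  -- [x]. Its reduced fraction `↥ q` / `↧ q` has the form -c/b with b = `↧ q`, whence the sign of c.
  represents-⟨⟩ : ∀ x α → _≈ℚ_ p p-prime x α → let q = α ℚ.- [_] p p-prime x in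
    Represents (⟨_⟩ p p-prime x) (↧ q) (ℤ.- ↥ q)
  represents-⟨⟩ x α x≈α = record
    { start≡0 = refl
    ; x∈pℤₚ   = in-ideal
    ; 0<b     = ℤ.+<+ (s≤s z≤n)
    ; coprime = coprime-↧-↥ q
    ; root    = λ m → let (N , v) = x≈α m in
        N , λ n N≤n → Valuation≥⇒p^∣ m (T n) q (subst (Valuation≥ p p-prime (+ m)) (eq n) (v n N≤n))
    }
    where
    I = [_] p p-prime x
    q = α ℚ.- I
    T = truncate (⟨_⟩ p p-prime x)
    eq : ∀ n → partialSum p p-prime x n ℚ.- α ≡ ι (T n) ℚ.- q
    eq n = trans (cong (ℚ._- α) (partialSum-⟨⟩ x n))
      (ℚ.+-*-Solver.solve 3 (λ I T α → I :+ T :- α := T :- (α :- I)) refl I (ι (T n)) α)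
      where open ℚ.+-*-Solver using (_:+_; _:-_; _:=_)
    in-ideal : InMaximalIdeal p p-prime (⟨_⟩ p p-prime x)
    in-ideal (+ zero)  _ = Fin.toℕ-fromℕ< (ℕ.>-nonZero⁻¹ p)
    in-ideal (+ suc _) (ℤ.+≤+ ())
    in-ideal -[1+ _ ]  _ = Fin.toℕ-fromℕ< (ℕ.>-nonZero⁻¹ p)

theorem9p1 : (p : ℕ) (p-prime : Prime p) (α : ℚ) (x : ℚₚ p p-prime) →
    _≈ℚ_ p p-prime x α →
    (alg : Algorithm) → FiniteExpansion p p-prime alg x
theorem9p1 p p-prime α x x≈α alg =
  let (τs , orbit) = orbit-rational p p-prime alg (represents-⟨⟩ p p-prime x α x≈α) in
  cf ([_] p p-prime x) τs , record { integral = refl ; orbit = orbit }
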